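{- Let $G$ be a finite unoriented simple graph with vertex set $\{1,\dots,n\}$, $n\ge 1$. Let $A$ be the adjacency matrix of $G$, let $D$ be the diagonal matrix whose $i$-th diagonal entry is the valency (degree) of the vertex $i$, and let $L=A-D$. Then the number of spanning trees of $G$ is equal to $|C(L)|$, where $C(L)$ denotes the common value of all the cofactors of $L$.
   Context: For an $n\times n$ matrix $L$, $M_{ij}(L)$ denotes the submatrix obtained by deleting the $i$-th row and the $j$-th column, and the $i,j$ cofactor of $L$ is $C_{ij}(L)=(-1)^{i+j}\det M_{ij}(L)$ (the determinant of the empty matrix is $1$). A matrix $L$ is called Laplace-like if it is symmetric and each of its rows sums to zero; the matrix $L=A-D$ is Laplace-like. If $L$ is Laplace-like then all its cofactors $C_{ij}(L)$ are equal, and $C(L)$ denotes their common value. A spanning tree of $G$ is a subgraph of $G$ that is a tree and contains all the vertices of $G$. -}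

module Defs where

open import Data.Bool.Base using (Bool; true; false; T; if_then_else_)
open import Data.Fin.Base using (Fin; zero; toℕ; punchIn)
open import Data.Fin.Properties using (_≟_)
open import Data.Fin.Subset using (Subset; _∈_; Nonempty; ∣_∣)
open import Data.Integer.Base using (ℤ; +_; 0ℤ; 1ℤ; -1ℤ; _^_; _*_; _-_)
open import Data.Integer.Properties using (+-0-commutativeMonoid)
open import Data.List.Base using (List; _∷_; _∷ʳ_; length)
open import Data.List.Relation.Unary.Linked using (Linked)
open import Data.List.Relation.Unary.Unique.Propositional using (Unique)
open import Data.Nat.Base as ℕ using (ℕ; zero; suc; _≤_)
open import Data.Product.Base using (Σ; _×_; _,_; proj₁)
open import Data.Vec.Base using (tabulate)
open import Data.Vec.Functional using (Vector)
open import Function.Bundles using (Bijection)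
open import Level using (Level; 0ℓ; _⊔_)
open import Relation.Binary.Bundles using (Setoid)
open import Relation.Binary.Construct.Closure.ReflexiveTransitive using (Star)
open import Relation.Binary.PropositionalEquality
  using (_≡_; refl; sym; trans; setoid)
open import Relation.Nullary using (¬_)
open import Relation.Nullary.Decidable using (does)

open import Algebra.Properties.CommutativeMonoid.Sum +-0-commutativeMonoid
  using (sum)

private
  variable
    n : ℕ
    a ℓ : Level

Matrix : ℕ → Set
Matrix n = Vector (Vector ℤ n) n

minor : Fin (suc n) → Fin (suc n) → Matrix (suc n) → Matrix n
minor i j L k l = L (punchIn i k) (punchIn j l)

-- The determinant is defined by Laplace expansion along the first row.
-- Indices start at 0 rather than 1, which does not change the parity of i + j.
mutual
  det : Matrix n → ℤ
  det {zero}  L = 1ℤ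
  det {suc n} L = sum (λ j → L zero j * cofactor zero j L)

  cofactor : Fin (suc n) → Fin (suc n) → Matrix (suc n) → ℤ
  cofactor i j L = (-1ℤ ^ (toℕ i ℕ.+ toℕ j)) * det (minor i j L)

IsCommonCofactor : Matrix (suc n) → ℤ → Set
IsCommonCofactor L c = ∀ i j → cofactor i j L ≡ c

record SimpleGraph (n : ℕ) : Set where
  field
    edge        : Fin n → Fin n → Bool
    edge-sym    : ∀ i j → edge i j ≡ edge j i
    edge-irrefl : ∀ i → edge i i ≡ false

  degree : Fin n → ℕ
  degree i = ∣ tabulate (edge i) ∣

  adjacency : Matrix n
  adjacency i j = if edge i j then 1ℤ else 0ℤ

  valency : Matrix n
  valency i j = if does (i ≟ j) then + degree i else 0ℤ

  laplacian : Matrix n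
  laplacian i j = adjacency i j - valency i j

record Subgraph (G : SimpleGraph n) : Set where
  private module G = SimpleGraph G
  field
    vertices      : Subset n
    edge          : Fin n → Fin n → Bool
    edge-sym      : ∀ i j → edge i j ≡ edge j i
    edge-in-graph : ∀ i j → T (edge i j) → T (G.edge i j)
    edge-source   : ∀ i j → T (edge i j) → i ∈ vertices

  Adj : Fin n → Fin n → Set
  Adj i j = T (edge i j)

  Connected : Set
  Connected = ∀ i j → i ∈ vertices → j ∈ vertices → Star Adj i j

  -- x ∷ xs lists, without repetition, the successive vertices of a cycle;
  -- a cycle has at least three of them.
  IsCycle : Fin n → List (Fin n) → Set
  IsCycle x xs = 2 ≤ length xs × Unique (x ∷ xs) × Linked Adj (x ∷ (xs ∷ʳ x))

  Acyclic : Set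
  Acyclic = ∀ x xs → ¬ IsCycle x xs

  IsTree : Set
  IsTree = Nonempty vertices × Connected × Acyclic

  IsSpanning : Set
  IsSpanning = ∀ i → i ∈ vertices

-- Subgraphs are equal when they have the same vertices and the same edges.
infix 4 _≈_
_≈_ : {G : SimpleGraph n} → Subgraph G → Subgraph G → Set
H ≈ K = H.vertices ≡ K.vertices × (∀ i j → H.edge i j ≡ K.edge i j)
  where
  module H = Subgraph H
  module K = Subgraph K

SpanningTree : SimpleGraph n → Set
SpanningTree G = Σ (Subgraph G) λ H → Subgraph.IsTree H × Subgraph.IsSpanning H

spanningTrees : SimpleGraph n → Setoid 0ℓ 0ℓ
spanningTrees G = record
  { Carrier       = SpanningTree G
  ; _≈_           = λ H K → proj₁ H ≈ proj₁ K
  ; isEquivalence = record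
    { refl  = refl , λ _ _ → refl
    ; sym   = λ (p , q) → sym p , λ i j → sym (q i j)
    ; trans = λ (p , q) (p′ , q′) → trans p p′ , λ i j → trans (q i j) (q′ i j)
    }
  }

infix 4 _HasCardinality_
_HasCardinality_ : Setoid a ℓ → ℕ → Set (a ⊔ ℓ)
S HasCardinality k = Bijection S (setoid (Fin k))

{-# OPTIONS --safe #-}

-- Fix a root r. Row i of the Laplacian is the sum, over the neighbours x of i,
-- of the rows δ x − δ i. Multilinearity therefore expands the principal minor
-- at r into a sum over all functions f assigning to each non-root vertex one of
-- its neighbours, of the determinants with rows δ (f i) − δ i. Eliminating one
-- vertex i short-circuits f through i, which shows that such a determinant is
-- ±1 (with a sign independent of f) if iterating f always leads to r and 0
-- otherwise. The functions leading to r are the parent functions of the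
-- spanning trees rooted at r. That all cofactors agree follows from column
-- operations within a row of cofactors and, between different rows, from the
-- fact that every principal minor counts the same trees.
module Submission where

open import Defs
open import Data.Nat.Base using (ℕ; suc)
open import Data.Integer.Base using (∣_∣)
open import Data.Product.Base using (_×_; ∃-syntax)

open import Data.Bool.Base using (Bool; true; false; T; if_then_else_)
open import Data.Bool.Properties using (T?)
open import Data.Empty using (⊥; ⊥-elim)
open import Data.Fin.Base using (Fin; zero; suc; toℕ; punchIn; punchOut; pinch)
open import Data.Fin.Permutation using (↔⇒≡)
open import Data.Fin.Properties
  using (_≟_; any?; suc-injective; punchInᵢ≢i; punchIn-injective; punchIn-punchOut)
import Data.Fin.Subset as Subset
open import Data.Fin.Subset.Properties using (∈⊤; ⊆⊤; ⊆-antisym)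
open import Data.Integer.Base using (ℤ; +_; 0ℤ; 1ℤ; -1ℤ; _+_; _-_; -_; _*_; _^_)
import Data.Integer.Properties as ℤₚ
open import Data.Integer.Tactic.RingSolver using (solve-∀)
open import Data.List.Base as List
  using (List; []; _∷_; _++_; _∷ʳ_; map; filter; cartesianProductWith; length)
open import Data.List.Membership.Propositional using (_∈_)
open import Data.List.Membership.Propositional.Properties
  using ( ∈-lookup; ∈-filter⁺; ∈-filter⁻; ∈-allFin
        ; ∈-cartesianProductWith⁺; ∈-cartesianProductWith⁻)
open import Data.List.Relation.Unary.All as All using (All; []; _∷_)
open import Data.List.Relation.Unary.All.Properties using (¬Any⇒All¬)
open import Data.List.Relation.Unary.AllPairs using ([]; _∷_)
open import Data.List.Relation.Unary.Any as Any using (here; there)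
open import Data.List.Relation.Unary.Any.Properties using (lookup-index)
open import Data.List.Relation.Unary.Linked using (Linked; [-]; _∷_)
open import Data.List.Relation.Unary.Unique.Propositional using (Unique)
import Data.List.Relation.Unary.Unique.Propositional.Properties as Unique
open import Data.Nat.Base as ℕ using (zero; _≤_; _<_; z≤n; s≤s)
open import Data.Nat.Induction using (<-wellFounded)
import Data.Nat.Properties as ℕₚ
open import Data.Product.Base using (∃; _,_; proj₁; proj₂)
open import Data.Sum.Base using (_⊎_; inj₁; inj₂; swap)
open import Data.Unit.Base using (⊤)
open import Data.Vec.Base as Vec using (Vec; []; _∷_; lookup)
open import Data.Vec.Properties
  using (lookup∘tabulate; tabulate∘lookup; tabulate-cong; ∷-injective)
open import Function.Base using (_∘_; flip; id)
open import Function.Bundles using (Bijection)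
open import Function.Properties.Bijection using (Bijection⇒Inverse)
open import Function.Properties.Inverse
  using (Inverse⇒Bijection) renaming (sym to Inverse-sym; trans to Inverse-trans)
open import Induction.WellFounded using (WellFounded; Acc; acc; module Subrelation)
open import Level using (0ℓ)
open import Relation.Binary.Bundles using (Setoid)
open import Relation.Binary.Construct.Closure.ReflexiveTransitive
  using (Star; ε; _◅_; _◅◅_; reverse; gmap)
open import Relation.Binary.Construct.Closure.Transitive as Transitive
  using (TransClosure; [_]; _∷_)
import Relation.Binary.Construct.On as On
open import Relation.Binary.PropositionalEquality
open import Relation.Nullary using (¬_; Dec; yes; no; contradiction)
open import Relation.Nullary.Decidable
  using ( does; isYes; toWitness; fromWitness; dec-true; dec-false
        ; _×-dec_; _⊎-dec_)

open import Algebra.Properties.CommutativeMonoid.Sum ℤₚ.+-0-commutativeMonoid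
  using (sum; sum-cong-≗; sum-remove; ∑-distrib-+; ∑-comm; sum-replicate-zero)
open import Algebra.Properties.Semiring.Sum ℤₚ.+-*-semiring
  using (*-distribˡ-sum; *-distribʳ-sum)

open ≡-Reasoning

private
  variable
    m n : ℕ
    A B C : Set

-- Determinants under column operations.

sign : ℕ → ℤ
sign k = -1ℤ ^ k

sign² : ∀ k → sign k * sign k ≡ 1ℤ
sign² zero    = refl
sign² (suc k) = trans (lemma (sign k)) (sign² k)
  where
  lemma : ∀ s → (-1ℤ * s) * (-1ℤ * s) ≡ s * s
  lemma = solve-∀

det-cong : {M N : Matrix n} → (∀ i j → M i j ≡ N i j) → det M ≡ det N
det-cong {zero}  eq = refl
det-cong {suc n} eq = sum-cong-≗ λ j → cong₂ _*_ (eq zero j)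
  (cong (sign (toℕ j) *_) (det-cong λ k l → eq (suc k) (punchIn j l)))

infixr 5 _◂_
_◂_ : {A : Set} → (A → ℤ) → (A → Fin n → ℤ) → A → Fin (suc n) → ℤ
(v ◂ K) i zero    = v i
(v ◂ K) i (suc k) = K i k

◂-cong : {A : Set} {v w : A → ℤ} {K L : A → Fin n → ℤ} →
         (∀ i → v i ≡ w i) → (∀ i k → K i k ≡ L i k) →
         ∀ i k → (v ◂ K) i k ≡ (w ◂ L) i k
◂-cong p q i zero    = p i
◂-cong p q i (suc k) = q i k


-- After the column punchIn j k is deleted, the former column j is at pinch k j.
punchIn-pinch : (j : Fin (suc (suc n))) (k : Fin (suc n)) →
                punchIn (punchIn j k) (pinch k j) ≡ j
punchIn-pinch           zero    k       = refl
punchIn-pinch           (suc j) zero    = refl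
punchIn-pinch {suc n}   (suc j) (suc k) = cong suc (punchIn-pinch j k)

punchIn-punchIn : (j : Fin (suc (suc n))) (k : Fin (suc n)) (l : Fin n) →
                  punchIn (punchIn j k) (punchIn (pinch k j) l) ≡
                  punchIn j (punchIn k l)
punchIn-punchIn zero    k       l       = refl
punchIn-punchIn (suc j) zero    l       = refl
punchIn-punchIn (suc j) (suc k) zero    = refl
punchIn-punchIn (suc j) (suc k) (suc l) = cong suc (punchIn-punchIn j k l)

-- Exchanging the order in which two columns are deleted shifts exactly one of the two indices by
-- one, hence the minus sign.
sign-pinch : (j : Fin (suc (suc n))) (k : Fin (suc n)) →
             sign (toℕ (punchIn j k)) * sign (toℕ (pinch k j)) ≡
             - (sign (toℕ j) * sign (toℕ k))
sign-pinch zero k = lemma (sign (toℕ k))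
  where
  lemma : ∀ s → (-1ℤ * s) * 1ℤ ≡ - (1ℤ * s)
  lemma = solve-∀
sign-pinch (suc j) zero = lemma (sign (toℕ j))
  where
  lemma : ∀ s → 1ℤ * s ≡ - ((-1ℤ * s) * 1ℤ)
  lemma = solve-∀
sign-pinch {suc n} (suc j) (suc k) = begin
  (-1ℤ * a) * (-1ℤ * b)  ≡⟨ cancel a b ⟩
  a * b                  ≡⟨ sign-pinch j k ⟩
  - (c * d)              ≡⟨ cong -_ (cancel c d) ⟨
  - ((-1ℤ * c) * (-1ℤ * d)) ∎
  where
  a = sign (toℕ (punchIn j k))
  b = sign (toℕ (pinch k j))
  c = sign (toℕ j)
  d = sign (toℕ k)
  cancel : ∀ s t → (-1ℤ * s) * (-1ℤ * t) ≡ s * t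
  cancel = solve-∀

-- Expand along the first row: the term of column `j` becomes the leading one, and in every other
-- term induction moves that column, now at `pinch k j`, to the front of the minor.
column-to-front : (M : Matrix (suc n)) (j : Fin (suc n)) →
                  det M ≡ sign (toℕ j) * det ((λ i → M i j) ◂ λ i → M i ∘ punchIn j)
column-to-front {zero}  M zero = lemma (M zero zero)
  where
  lemma : ∀ x → x * (1ℤ * 1ℤ) + 0ℤ ≡ 1ℤ * (x * (1ℤ * 1ℤ) + 0ℤ)
  lemma = solve-∀
column-to-front {suc n} M j = begin
  sum t                                         ≡⟨ sum-remove {i = j} t ⟩
  M zero j * (s * D) + sum (t ∘ punchIn j)
    ≡⟨ cong (λ z → M zero j * (s * D) + z) (sum-cong-≗ step) ⟩
  M zero j * (s * D) + sum (λ k → s * u k)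
    ≡⟨ cong (λ z → M zero j * (s * D) + z) (*-distribˡ-sum s u) ⟨
  M zero j * (s * D) + s * sum u                ≡⟨ lemma (M zero j) s D (sum u) ⟩
  s * (M zero j * (1ℤ * D) + sum u)             ∎
  where
  s = sign (toℕ j)
  D = det (minor zero j M)
  F = (λ i → M i j) ◂ λ i → M i ∘ punchIn j
  t u : Fin _ → ℤ
  t k = M zero k * cofactor zero k M
  u k = F zero (suc k) * cofactor zero (suc k) F

  lemma : ∀ x s d y → x * (s * d) + s * y ≡ s * (x * (1ℤ * d) + y)
  lemma = solve-∀

  rearrange : ∀ x a b d → x * (a * (b * d)) ≡ x * ((a * b) * d)
  rearrange = solve-∀

  rearrange′ : ∀ x a b d → x * ((- (a * b)) * d) ≡ a * (x * ((-1ℤ * b) * d))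
  rearrange′ = solve-∀

  step : ∀ k → t (punchIn j k) ≡ s * u k
  step k = begin
    x * (a * det (minor zero (punchIn j k) M))
      ≡⟨ cong (λ d → x * (a * d)) (column-to-front N (pinch k j)) ⟩
    x * (a * (b * det N′))
      ≡⟨ cong (λ d → x * (a * (b * d))) (det-cong eq) ⟩
    x * (a * (b * d))                ≡⟨ rearrange x a b d ⟩
    x * ((a * b) * d)                ≡⟨ cong (λ y → x * (y * d)) (sign-pinch j k) ⟩
    x * ((- (s * sign (toℕ k))) * d) ≡⟨ rearrange′ x s (sign (toℕ k)) d ⟩
    s * u k                          ∎
    where
    x = M zero (punchIn j k)
    a = sign (toℕ (punchIn j k))
    b = sign (toℕ (pinch k j))
    d = det (minor zero (suc k) F)
    N N′ : Matrix (suc n)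
    N  = minor zero (punchIn j k) M
    N′ = (λ i → N i (pinch k j)) ◂ λ i → N i ∘ punchIn (pinch k j)
    eq : ∀ i l → N′ i l ≡ minor zero (suc k) F i l
    eq i zero    = cong (M (suc i)) (punchIn-pinch j k)
    eq i (suc l) = cong (M (suc i)) (punchIn-punchIn j k l)

-- In the expansion along the first row, the added column supplies the entry of the first term and
-- survives as the first column of every other minor, where induction applies.
det-◂-+ : (v w : Fin (suc n) → ℤ) (K : Fin (suc n) → Fin n → ℤ) →
          det ((λ i → v i + w i) ◂ K) ≡ det (v ◂ K) + det (w ◂ K)
det-◂-+ {n} v w K = begin
  (v zero + w zero) * (1ℤ * D) + sum (λ k → t (λ i → v i + w i) k)
    ≡⟨ cong (λ z → (v zero + w zero) * (1ℤ * D) + z)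
         (trans (sum-cong-≗ step) (∑-distrib-+ (t v) (t w))) ⟩
  (v zero + w zero) * (1ℤ * D) + (sum (t v) + sum (t w))
    ≡⟨ lemma (v zero) (w zero) D (sum (t v)) (sum (t w)) ⟩
  (v zero * (1ℤ * D) + sum (t v)) + (w zero * (1ℤ * D) + sum (t w)) ∎
  where
  D = det (λ i k → K (suc i) k)
  t : (Fin (suc n) → ℤ) → Fin n → ℤ
  t x k = K zero k * cofactor zero (suc k) (x ◂ K)

  lemma : ∀ a b d x y → (a + b) * (1ℤ * d) + (x + y) ≡ (a * (1ℤ * d) + x) + (b * (1ℤ * d) + y)
  lemma = solve-∀

  distrib : ∀ x a d e → x * (a * (d + e)) ≡ x * (a * d) + x * (a * e)
  distrib = solve-∀

  minor-◂ : ∀ {n} (x : Fin (suc (suc n)) → ℤ) (K : Fin (suc (suc n)) → Fin (suc n) → ℤ) k i l →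
            minor zero (suc k) (x ◂ K) i l ≡ ((x ∘ suc) ◂ λ i → K (suc i) ∘ punchIn k) i l
  minor-◂ x K k i zero    = refl
  minor-◂ x K k i (suc l) = refl

  -- The size is quantified anew because `k : Fin n` makes it positive, and the recursive call needs
  -- that successor exposed.
  det-minor : ∀ {n} (v w : Fin (suc n) → ℤ) (K : Fin (suc n) → Fin n → ℤ) k →
    det (minor zero (suc k) ((λ i → v i + w i) ◂ K)) ≡
    det (minor zero (suc k) (v ◂ K)) + det (minor zero (suc k) (w ◂ K))
  det-minor {suc n} v w K k =
    trans (det-cong (minor-◂ (λ i → v i + w i) K k))
      (trans (det-◂-+ (v ∘ suc) (w ∘ suc) (λ i → K (suc i) ∘ punchIn k))
        (sym (cong₂ _+_ (det-cong (minor-◂ v K k)) (det-cong (minor-◂ w K k)))))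

  step : ∀ k → t (λ i → v i + w i) k ≡ t v k + t w k
  step k = trans (cong (λ d → K zero k * (sign (suc (toℕ k)) * d)) (det-minor v w K k))
    (distrib (K zero k) (sign (suc (toℕ k))) _ _)

-- Cofactors of matrices with zero row sums.

RowSumsZero : (Fin m → Fin n → ℤ) → Set
RowSumsZero M = ∀ i → sum (M i) ≡ 0ℤ

-- Deleting column 0 or column suc j leaves, up to sign, the same matrix except
-- for one column. Adding the two determinants in that column gives the
-- determinant of a square matrix with zero row sums, and this one vanishes by
-- the case of one row fewer.
mutual
  det-delete-column : (M : Fin n → Fin (suc n) → ℤ) → RowSumsZero M → ∀ j →
                      sign (toℕ j) * det (λ i → M i ∘ punchIn j) ≡ det (λ i → M i ∘ suc)
  det-delete-column         M rs zero    = ℤₚ.*-identityˡ _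
  det-delete-column {suc n} M rs (suc j) = begin
    (-1ℤ * s) * det (λ i → M i ∘ punchIn (suc j))
      ≡⟨ cong ((-1ℤ * s) *_) (det-cong eq) ⟩
    (-1ℤ * s) * x        ≡⟨ lemma s x y ⟩
    s * y - s * (x + y)  ≡⟨ cong (λ z → s * y - s * z) x+y≡0 ⟩
    s * y - s * 0ℤ       ≡⟨ lemma′ s y ⟩
    s * y                ≡⟨ column-to-front (λ i → M i ∘ suc) j ⟨
    det (λ i → M i ∘ suc) ∎
    where
    s = sign (toℕ j)
    K : Fin (suc n) → Fin n → ℤ
    K i = M i ∘ suc ∘ punchIn j
    c₀ cⱼ : Fin (suc n) → ℤ
    c₀ i = M i zero
    cⱼ i = M i (suc j)
    x = det (c₀ ◂ K)
    y = det (cⱼ ◂ K)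

    eq : ∀ i l → M i (punchIn (suc j) l) ≡ (c₀ ◂ K) i l
    eq i zero    = refl
    eq i (suc l) = refl

    lemma : ∀ s x y → (-1ℤ * s) * x ≡ s * y - s * (x + y)
    lemma = solve-∀

    lemma′ : ∀ s y → s * y - s * 0ℤ ≡ s * y
    lemma′ = solve-∀

    x+y≡0 : x + y ≡ 0ℤ
    x+y≡0 = trans (sym (det-◂-+ c₀ cⱼ K)) (det-rowSumsZero ((λ i → c₀ i + cⱼ i) ◂ K) λ i → begin
      (M i zero + M i (suc j)) + sum (K i)   ≡⟨ ℤₚ.+-assoc (M i zero) _ _ ⟩
      M i zero + (M i (suc j) + sum (K i))
        ≡⟨ cong (λ z → M i zero + z) (sum-remove {i = j} (M i ∘ suc)) ⟨
      sum (M i)                              ≡⟨ rs i ⟩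
      0ℤ                                     ∎)

  det-rowSumsZero : (M : Matrix (suc n)) → RowSumsZero M → det M ≡ 0ℤ
  det-rowSumsZero M rs = begin
    det M
      -- All cofactors along the first row equal `d`, so the first row sum factors out.
      ≡⟨ sum-cong-≗ (λ j → cong (M zero j *_) (det-delete-column (M ∘ suc) (rs ∘ suc) j)) ⟩
    sum (λ j → M zero j * d)     ≡⟨ *-distribʳ-sum d (M zero) ⟨
    sum (M zero) * d             ≡⟨ cong (_* d) (rs zero) ⟩
    0ℤ * d                       ≡⟨ ℤₚ.*-zeroˡ d ⟩
    0ℤ                           ∎
    where d = det (λ i → M (suc i) ∘ suc)

-- Within row `i`, the signed deletions of column `j` and of column `i` both amount to the deletion
-- of column 0; the sign of `i` then occurs twice and cancels.
cofactor-diagonal : (L : Matrix (suc n)) → RowSumsZero L → ∀ i j →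
                    cofactor i j L ≡ det (minor i i L)
cofactor-diagonal L rs i j = begin
  sign (toℕ i ℕ.+ toℕ j) * det (minor i j L)       ≡⟨ split j ⟩
  s * (sign (toℕ j) * det (minor i j L))           ≡⟨ cong (s *_) (delete j) ⟩
  s * det (λ k → L (punchIn i k) ∘ suc)            ≡⟨ cong (s *_) (delete i) ⟨
  s * (s * det (minor i i L))                      ≡⟨ ℤₚ.*-assoc s s _ ⟨
  s * s * det (minor i i L)                        ≡⟨ cong (_* det (minor i i L)) (sign² (toℕ i)) ⟩
  1ℤ * det (minor i i L)                           ≡⟨ ℤₚ.*-identityˡ _ ⟩
  det (minor i i L)                                ∎
  where
  s = sign (toℕ i)

  delete : ∀ j → sign (toℕ j) * det (minor i j L) ≡ det (λ k → L (punchIn i k) ∘ suc)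
  delete = det-delete-column (L ∘ punchIn i) (rs ∘ punchIn i)

  split : ∀ j → sign (toℕ i ℕ.+ toℕ j) * det (minor i j L) ≡
                s * (sign (toℕ j) * det (minor i j L))
  split j = trans (cong (_* det (minor i j L)) (ℤₚ.^-distribˡ-+-* -1ℤ (toℕ i) (toℕ j)))
                  (ℤₚ.*-assoc s _ _)

-- Sums over lists and multilinearity in the rows.

sumOver : List A → (A → ℤ) → ℤ
sumOver xs g = sum (g ∘ List.lookup xs)

sumOver-++ : (xs ys : List A) (g : A → ℤ) → sumOver (xs ++ ys) g ≡ sumOver xs g + sumOver ys g
sumOver-++ []       ys g = sym (ℤₚ.+-identityˡ _)
sumOver-++ (x ∷ xs) ys g =
  trans (cong (λ s → g x + s) (sumOver-++ xs ys g)) (sym (ℤₚ.+-assoc (g x) _ _))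

sumOver-map : (h : A → B) (xs : List A) (g : B → ℤ) → sumOver (map h xs) g ≡ sumOver xs (g ∘ h)
sumOver-map h []       g = refl
sumOver-map h (x ∷ xs) g = cong (λ s → g (h x) + s) (sumOver-map h xs g)

sumOver-cartesianProductWith :
  (h : A → B → C) (xs : List A) (ys : List B) (g : C → ℤ) →
  sumOver (cartesianProductWith h xs ys) g ≡ sumOver xs λ x → sumOver ys λ y → g (h x y)
sumOver-cartesianProductWith h []       ys g = refl
sumOver-cartesianProductWith h (x ∷ xs) ys g =
  trans (sumOver-++ (map (h x) ys) _ g)
    (cong₂ _+_ (sumOver-map (h x) ys g) (sumOver-cartesianProductWith h xs ys g))

-- Vectors stand for choice functions, so that membership and distinctness can be stated with
-- propositional equality.
choices : (Fin n → List A) → List (Vec A n)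
choices {zero}  xs = [] ∷ []
choices {suc n} xs = cartesianProductWith _∷_ (xs zero) (choices (xs ∘ suc))

-- The first row is expanded by distributivity and the minors by induction; the sum over columns is
-- then exchanged with both list sums.
det-rows : (xs : Fin n → List A) (R : Fin n → A → Fin n → ℤ) →
           det (λ i j → sumOver (xs i) λ x → R i x j) ≡
           sumOver (choices xs) λ v → det λ i → R i (lookup v i)
det-rows {zero}      xs R = refl
det-rows {suc n} {A} xs R = begin
  sum (λ j → sumOver (xs zero) (λ x → R zero x j) * (s j * det (N j)))
    ≡⟨ sum-cong-≗ expand ⟩
  sum (λ j → sumOver (xs zero) λ x → sumOver vs λ v → t x v j)
    ≡⟨ ∑-comm (λ j k → sumOver vs λ v → t (List.lookup (xs zero) k) v j) ⟩
  sumOver (xs zero) (λ x → sum λ j → sumOver vs λ v → t x v j)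
    ≡⟨ sum-cong-≗ (λ k → ∑-comm (λ j l → t (List.lookup (xs zero) k) (List.lookup vs l) j)) ⟩
  sumOver (xs zero) (λ x → sumOver vs λ v → sum λ j → t x v j)
    ≡⟨ sumOver-cartesianProductWith _∷_ (xs zero) vs (λ v → det λ i → R i (lookup v i)) ⟨
  sumOver (choices xs) (λ v → det λ i → R i (lookup v i)) ∎
  where
  vs = choices (xs ∘ suc)
  s : Fin (suc n) → ℤ
  s j = sign (toℕ j)
  N : Fin (suc n) → Matrix n
  N j i k = sumOver (xs (suc i)) λ x → R (suc i) x (punchIn j k)
  D : Fin (suc n) → Vec A n → ℤ
  D j v = det λ i k → R (suc i) (lookup v i) (punchIn j k)
  t : A → Vec A n → Fin (suc n) → ℤ
  t x v j = R zero x j * (s j * D j v)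

  expand : ∀ j → sumOver (xs zero) (λ x → R zero x j) *
                 (s j * det (N j)) ≡
                 sumOver (xs zero) λ x → sumOver vs λ v → t x v j
  expand j = begin
    a * (s j * det (N j))
      ≡⟨ cong (λ d → a * (s j * d)) (det-rows (xs ∘ suc) (λ i x → R (suc i) x ∘ punchIn j)) ⟩
    a * (s j * sumOver vs (D j))
      ≡⟨ cong (a *_) (*-distribˡ-sum (s j) (D j ∘ List.lookup vs)) ⟩
    a * sumOver vs (λ v → s j * D j v)
      ≡⟨ *-distribʳ-sum (sumOver vs λ v → s j * D j v) (λ k → R zero (List.lookup (xs zero) k) j) ⟩
    sumOver (xs zero) (λ x → R zero x j * sumOver vs λ v → s j * D j v)
      ≡⟨ sum-cong-≗ (λ k → *-distribˡ-sum (R zero (List.lookup (xs zero) k) j)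
                                         (λ l → s j * D j (List.lookup vs l))) ⟩
    sumOver (xs zero) (λ x → sumOver vs λ v → t x v j) ∎
    where a = sumOver (xs zero) λ x → R zero x j

-- The Laplacian as a sum of difference rows.

δ : Fin m → Fin m → ℤ
δ x y = if does (x ≟ y) then 1ℤ else 0ℤ

δ-≡ : {x y : Fin m} → x ≡ y → δ x y ≡ 1ℤ
δ-≡ {x = x} {y} x≡y = cong (if_then 1ℤ else 0ℤ) (dec-true (x ≟ y) x≡y)

δ-≢ : {x y : Fin m} → x ≢ y → δ x y ≡ 0ℤ
δ-≢ {x = x} {y} x≢y = cong (if_then 1ℤ else 0ℤ) (dec-false (x ≟ y) x≢y)

sum-zero : (t : Fin n → ℤ) → (∀ i → t i ≡ 0ℤ) → sum t ≡ 0ℤ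
sum-zero {n} t eq = trans (sum-cong-≗ eq) (sum-replicate-zero n)

sum-single : (i : Fin n) (t : Fin n → ℤ) → (∀ j → j ≢ i → t j ≡ 0ℤ) → sum t ≡ t i
sum-single {suc n} i t eq = begin
  sum t                      ≡⟨ sum-remove {i = i} t ⟩
  t i + sum (t ∘ punchIn i)  ≡⟨ cong (λ s → t i + s) (sum-zero _ λ j → eq _ (punchInᵢ≢i i j)) ⟩
  t i + 0ℤ                   ≡⟨ ℤₚ.+-identityʳ (t i) ⟩
  t i                        ∎

members : (Fin m → Bool) → List (Fin m)
members p = filter (T? ∘ p) (List.allFin _)

-- Stated for `tabulate h` instead of `allFin`, so that induction can pass to `h ∘ suc`.
sumOver-filter : (p : A → Bool) (h : Fin m → A) (g : A → ℤ) →
  sumOver (filter (T? ∘ p) (List.tabulate h)) g ≡ sum λ i → if p (h i) then g (h i) else 0ℤ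
sumOver-filter {m = zero}  p h g = refl
sumOver-filter {m = suc m} p h g with p (h zero)
... | true  = cong (λ s → g (h zero) + s) (sumOver-filter p (h ∘ suc) g)
... | false = trans (sumOver-filter p (h ∘ suc) g) (sym (ℤₚ.+-identityˡ _))

sum-if : (p : Fin m → Bool) (c : ℤ) →
         sum (λ i → if p i then c else 0ℤ) ≡ + Subset.∣ Vec.tabulate p ∣ * c
sum-if {zero}  p c = sym (ℤₚ.*-zeroˡ c)
sum-if {suc m} p c with p zero
... | true  = trans (cong (λ s → c + s) (sum-if (p ∘ suc) c))
                    (sym (ℤₚ.suc-* (+ Subset.∣ Vec.tabulate (p ∘ suc) ∣) c))
... | false = trans (ℤₚ.+-identityˡ _) (sum-if (p ∘ suc) c)

module _ (G : SimpleGraph m) where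
  open SimpleGraph G

  neighbours : Fin m → List (Fin m)
  neighbours u = members (edge u)

  -- The terms `δ x w` add up to the adjacency entry, and `- δ u w` is repeated `degree u` times,
  -- which gives the diagonal.
  laplacian-row : ∀ u w → laplacian u w ≡ sumOver (neighbours u) λ x → δ x w - δ u w
  laplacian-row u w = sym (begin
    sumOver (neighbours u) (λ x → δ x w - δ u w)
      ≡⟨ sumOver-filter (edge u) (λ x → x) (λ x → δ x w - δ u w) ⟩
    sum (λ x → if edge u x then δ x w - δ u w else 0ℤ)
      ≡⟨ sum-cong-≗ (λ x → split (edge u x) (δ x w)) ⟩
    sum (λ x → a x + b x)
      ≡⟨ ∑-distrib-+ a b ⟩
    sum a + sum b
      ≡⟨ cong₂ _+_ sum-a (sum-if (edge u) (- δ u w)) ⟩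
    adjacency u w + + degree u * - δ u w
      ≡⟨ cong (λ s → adjacency u w + s) (trans (sym (ℤₚ.neg-distribʳ-* (+ degree u) (δ u w)))
                                               (cong -_ degree-δ)) ⟩
    laplacian u w ∎)
    where
    a b : Fin m → ℤ
    a x = if edge u x then δ x w else 0ℤ
    b x = if edge u x then - δ u w else 0ℤ

    split : ∀ c d → (if c then d - δ u w else 0ℤ) ≡
                    (if c then d else 0ℤ) + (if c then - δ u w else 0ℤ)
    split true  d = refl
    split false d = refl

    sum-a : sum a ≡ adjacency u w
    sum-a = trans (sum-single w a vanish)
                  (cong (if edge u w then_else 0ℤ) (δ-≡ {x = w} refl))
      where
      vanish : ∀ x → x ≢ w → a x ≡ 0ℤ
      vanish x x≢w with edge u x
      ... | true  = δ-≢ x≢w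
      ... | false = refl

    degree-δ : + degree u * δ u w ≡ valency u w
    degree-δ with does (u ≟ w)
    ... | true  = ℤₚ.*-identityʳ _
    ... | false = ℤₚ.*-zeroʳ (+ degree u)

  laplacian-rowSumsZero : RowSumsZero laplacian
  laplacian-rowSumsZero u = begin
    sum (laplacian u)  ≡⟨ sum-cong-≗ (laplacian-row u) ⟩
    sum (λ w → sumOver (neighbours u) λ x → δ x w - δ u w)
      ≡⟨ ∑-comm (λ w k → δ (List.lookup (neighbours u) k) w - δ u w) ⟩
    sumOver (neighbours u) (λ x → sum λ w → δ x w - δ u w)
      ≡⟨ sum-zero _ (λ k → difference (List.lookup (neighbours u) k)) ⟩
    0ℤ ∎
    where
    sum-δ : ∀ x → sum (δ x) ≡ 1ℤ
    sum-δ x = trans (sum-single x (δ x) λ w w≢x → δ-≢ (w≢x ∘ sym)) (δ-≡ {x = x} refl)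

    difference : ∀ x → sum (λ w → δ x w - δ u w) ≡ 0ℤ
    difference x = begin
      sum (λ w → δ x w - δ u w)          ≡⟨ ∑-distrib-+ (δ x) (λ w → - δ u w) ⟩
      sum (δ x) + sum (λ w → - δ u w)
        ≡⟨ cong (λ s → sum (δ x) + s) (sum-cong-≗ (λ w → ℤₚ.-1*i≡-i (δ u w))) ⟨
      sum (δ x) + sum (λ w → -1ℤ * δ u w)
        ≡⟨ cong (λ s → sum (δ x) + s) (*-distribˡ-sum -1ℤ (δ u)) ⟨
      sum (δ x) + -1ℤ * sum (δ u)        ≡⟨ cong₂ (λ a b → a + -1ℤ * b) (sum-δ x) (sum-δ u) ⟩
      0ℤ                                 ∎

  -- Each `v` picks one neighbour for every listed vertex; with `e` equal to `punchIn r` the left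
  -- side is the principal minor at `r`.
  det-minor-laplacian : ∀ {n} (e : Fin n → Fin m) →
    det (λ i k → laplacian (e i) (e k)) ≡
    sumOver (choices (neighbours ∘ e)) λ v → det λ i k → δ (lookup v i) (e k) - δ (e i) (e k)
  det-minor-laplacian e = trans (det-cong λ i k → laplacian-row (e i) (e k))
    (det-rows (neighbours ∘ e) λ i x k → δ x (e k) - δ (e i) (e k))

-- Elimination of a pivot -1.

row-entry-zero : (M : Matrix (suc n)) (k : Fin (suc n)) → M zero k ≡ 0ℤ →
                 M zero k * cofactor zero k M ≡ 0ℤ
row-entry-zero M k eq = trans (cong (_* cofactor zero k M) eq) (ℤₚ.*-zeroˡ (cofactor zero k M))

-- The Schur complement of a pivot -1: dividing by the pivot turns the usual minus sign into a plus.
schurComplement : Matrix (suc n) → Matrix n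
schurComplement M i k = M (suc i) (suc k) + M (suc i) zero * M zero (suc k)

det-pivot-zero : (M : Matrix (suc n)) → M zero zero ≡ -1ℤ → (∀ k → M zero (suc k) ≡ 0ℤ) →
                 det M ≡ -1ℤ * det (schurComplement M)
det-pivot-zero M pivot row = begin
  M zero zero * (1ℤ * det N) + sum t
    ≡⟨ cong₂ (λ p s → p * (1ℤ * det N) + s) pivot
         (sum-zero t λ k → row-entry-zero M (suc k) (row k)) ⟩
  -1ℤ * (1ℤ * det N) + 0ℤ       ≡⟨ lemma (det N) ⟩
  -1ℤ * det N                   ≡⟨ cong (-1ℤ *_) (det-cong schur) ⟨
  -1ℤ * det (schurComplement M) ∎
  where
  N : Matrix _
  N i k = M (suc i) (suc k)
  t : Fin _ → ℤ
  t k = M zero (suc k) * cofactor zero (suc k) M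

  lemma : ∀ d → -1ℤ * (1ℤ * d) + 0ℤ ≡ -1ℤ * d
  lemma = solve-∀

  lemma′ : ∀ x c → x + c * 0ℤ ≡ x
  lemma′ = solve-∀

  schur : ∀ i k → schurComplement M i k ≡ N i k
  schur i k = trans (cong (λ z → N i k + M (suc i) zero * z) (row k))
                    (lemma′ (N i k) (M (suc i) zero))

-- Two terms of the expansion survive. The Schur complement changes only column `j`, by adding the
-- first column to it, and additivity in that column yields the same two terms.
det-pivot-unit : (M : Matrix (suc (suc n))) (j : Fin (suc n)) → M zero zero ≡ -1ℤ →
  M zero (suc j) ≡ 1ℤ → (∀ k → k ≢ j → M zero (suc k) ≡ 0ℤ) →
  det M ≡ -1ℤ * det (schurComplement M)
det-pivot-unit {n} M j pivot one row = begin
  M zero zero * (1ℤ * det N) + sum t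
    ≡⟨ cong₂ (λ p s → p * (1ℤ * det N) + s) pivot
         (sum-single j t λ k k≢j → row-entry-zero M (suc k) (row k k≢j)) ⟩
  -1ℤ * (1ℤ * det N) + M zero (suc j) * ((-1ℤ * s) * det (minor zero (suc j) M))
    ≡⟨ cong₂ (λ p d → -1ℤ * (1ℤ * det N) + p * ((-1ℤ * s) * d)) one (det-cong minor-eq) ⟩
  -1ℤ * (1ℤ * det N) + 1ℤ * ((-1ℤ * s) * det (c ◂ K))
    ≡⟨ cong (λ d → -1ℤ * (1ℤ * d) + 1ℤ * ((-1ℤ * s) * det (c ◂ K))) (column-to-front N j) ⟩
  -1ℤ * (1ℤ * (s * det (b ◂ K))) + 1ℤ * ((-1ℤ * s) * det (c ◂ K))
    ≡⟨ lemma s (det (b ◂ K)) (det (c ◂ K)) ⟩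
  -1ℤ * (s * (det (b ◂ K) + det (c ◂ K)))
    ≡⟨ cong (λ d → -1ℤ * (s * d)) (det-◂-+ b c K) ⟨
  -1ℤ * (s * det ((λ i → b i + c i) ◂ K))
    ≡⟨ cong (λ d → -1ℤ * (s * d)) (det-cong front-eq) ⟨
  -1ℤ * (s * det ((λ i → P i j) ◂ λ i → P i ∘ punchIn j))
    ≡⟨ cong (-1ℤ *_) (column-to-front P j) ⟨
  -1ℤ * det P ∎
  where
  s = sign (toℕ j)
  N P : Matrix (suc n)
  N i k = M (suc i) (suc k)
  P = schurComplement M
  b c : Fin (suc n) → ℤ
  b i = N i j
  c i = M (suc i) zero
  K : Fin (suc n) → Fin n → ℤ
  K i = N i ∘ punchIn j
  t : Fin (suc n) → ℤ
  t k = M zero (suc k) * cofactor zero (suc k) M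

  minor-eq : ∀ i k → minor zero (suc j) M i k ≡ (c ◂ K) i k
  minor-eq i zero    = refl
  minor-eq i (suc k) = refl

  front-eq : ∀ i k → ((λ i → P i j) ◂ λ i → P i ∘ punchIn j) i k ≡ ((λ i → b i + c i) ◂ K) i k
  front-eq = ◂-cong
    (λ i → cong (λ x → b i + x) (trans (cong (c i *_) one) (ℤₚ.*-identityʳ (c i))))
    (λ i k → trans (cong (λ x → K i k + x) (trans (cong (c i *_) (row _ (punchInᵢ≢i j k)))
                                                  (ℤₚ.*-zeroʳ (c i))))
                   (ℤₚ.+-identityʳ (K i k)))

  lemma : ∀ s x y → -1ℤ * (1ℤ * (s * x)) + 1ℤ * ((-1ℤ * s) * y) ≡ -1ℤ * (s * (x + y))
  lemma = solve-∀

-- Parent functions and their determinants.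

-- e lists the non-root vertices, and f i is the parent of the vertex e i.
Parent : (f e : Fin n → Fin m) → Fin m → Fin m → Set
Parent f e x y = ∃ λ i → e i ≡ x × f i ≡ y

-- Only vertices listed by `e` have a parent, so if `e` omits just the root, well-foundedness says
-- that iterating parents always ends at the root.
Rooted : (f e : Fin n → Fin m) → Set
Rooted f e = WellFounded (flip (Parent f e))

acc-irrefl : {_<_ : A → A → Set} {x : A} → Acc _<_ x → ¬ (x < x)
acc-irrefl (acc rs) x<x = acc-irrefl (rs x<x) x<x

parentMatrix : (f e : Fin n → Fin m) → Matrix n
parentMatrix f e i k = δ (f i) (e k) - δ (e i) (e k)

Injective : (Fin n → Fin m) → Set
Injective e = ∀ {i j} → e i ≡ e j → i ≡ j

-- The elimination of e zero: pointers to it are redirected to its own parent.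
contract : (f e : Fin (suc n) → Fin m) → Fin n → Fin m
contract f e i = if does (f (suc i) ≟ e zero) then f zero else f (suc i)

module _ (f e : Fin (suc n) → Fin m) (e-inj : Injective e) where

  private
    M = parentMatrix f e
    f′ = contract f e
    e′ = e ∘ suc
    e₀≢e′ : ∀ k → e zero ≢ e′ k
    e₀≢e′ k eq with () ← e-inj eq

  -- `M (suc i) zero` is 1 if `f (suc i)` is `e zero` and 0 otherwise, so row zero is added exactly
  -- to the rows that point to `e zero`, redirecting them to `f zero`.
  parentMatrix-contract : ∀ i k →
    parentMatrix f′ e′ i k ≡ schurComplement M i k
  parentMatrix-contract i k
    rewrite δ-≢ (e₀≢e′ k) | δ-≢ (e₀≢e′ i ∘ sym) with f (suc i) ≟ e zero
  ... | yes eq rewrite eq | δ-≢ (e₀≢e′ k) = lemma (δ (f zero) (e′ k)) (δ (e′ i) (e′ k))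
    where
    lemma : ∀ x y → x - y ≡ (0ℤ - y) + (1ℤ - 0ℤ) * (x - 0ℤ)
    lemma = solve-∀
  ... | no  _  = lemma (δ (f (suc i)) (e′ k)) (δ (f zero) (e′ k)) (δ (e′ i) (e′ k))
    where
    lemma : ∀ x z y → x - y ≡ (x - y) + (0ℤ - 0ℤ) * (z - 0ℤ)
    lemma = solve-∀

  -- The pivot is -1, and the rest of row zero has at most one nonzero entry: a 1 in the column of
  -- `f zero`, if that vertex is listed.
  det-contract : f zero ≢ e zero → det M ≡ -1ℤ * det (parentMatrix f′ e′)
  det-contract f₀≢e₀ = trans expansion (cong (-1ℤ *_) (sym (det-cong parentMatrix-contract)))
    where
    M₀₀ : M zero zero ≡ -1ℤ
    M₀₀ = cong₂ _-_ (δ-≢ f₀≢e₀) (δ-≡ {x = e zero} refl)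

    M₀ : ∀ k → M zero (suc k) ≡ δ (f zero) (e′ k)
    M₀ k = trans (cong (λ d → δ (f zero) (e′ k) - d) (δ-≢ (e₀≢e′ k))) (ℤₚ.+-identityʳ _)

    -- Since `j : Fin n`, the size is a successor, as `det-pivot-unit` requires.
    unit : ∀ {n} (M : Matrix (suc n)) (j : Fin n) → M zero zero ≡ -1ℤ → M zero (suc j) ≡ 1ℤ →
           (∀ k → k ≢ j → M zero (suc k) ≡ 0ℤ) → det M ≡ -1ℤ * det (schurComplement M)
    unit {suc n} = det-pivot-unit

    expansion : det M ≡ -1ℤ * det (schurComplement M)
    expansion with any? (λ j → f zero ≟ e′ j)
    ... | no  f₀∉e′ = det-pivot-zero M M₀₀ λ k → trans (M₀ k) (δ-≢ λ eq → f₀∉e′ (k , eq))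
    ... | yes (j , f₀≡e′) = unit M j M₀₀ (trans (M₀ j) (δ-≡ f₀≡e′)) λ k k≢j →
          trans (M₀ k) (δ-≢ λ eq → k≢j (suc-injective (e-inj (trans (sym eq) f₀≡e′))))

  -- A redirected pointer replaces two original steps, the first of them to `e zero`.
  parent-contract : ∀ {x y} → Parent f′ e′ x y → TransClosure (flip (Parent f e)) y x
  parent-contract (i , refl , refl) with f (suc i) ≟ e zero
  ... | yes eq = (zero , refl , refl) ∷ [ suc i , refl , eq ]
  ... | no  _  = [ suc i , refl , refl ]

  rooted-contract : Rooted f e → Rooted f′ e′
  rooted-contract wf x = parents (transitive wf x)
    where
    transitive : Rooted f e → WellFounded (TransClosure (flip (Parent f e)))
    transitive = Transitive.wellFounded _
    parents : ∀ {x} → Acc (TransClosure (flip (Parent f e))) x → Acc (flip (Parent f′ e′)) x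
    parents = Subrelation.accessible parent-contract

  -- Recursion follows the contracted pointers; where the original pointer leads to `e zero`,
  -- accessibility of `f zero` is first passed on to `e zero`.
  rooted-expand : f zero ≢ e zero → Rooted f′ e′ → Rooted f e
  rooted-expand f₀≢e₀ wf = rooted
    where
    from-f₀ : Acc (flip (Parent f e)) (f zero) → Acc (flip (Parent f e)) (e zero)
    from-f₀ a = acc λ where
      (i , eᵢ≡e₀ , refl) → subst (λ k → Acc _ (f k)) (sym (e-inj eᵢ≡e₀)) a

    rooted′ : ∀ {x} → x ≢ e zero → Acc (flip (Parent f′ e′)) x → Acc (flip (Parent f e)) x
    rooted′ {x} x≢e₀ (acc rs) = acc λ where
        (zero  , e₀≡x , _)   → contradiction (sym e₀≡x) x≢e₀
        (suc i , eᵢ≡x , refl) → parent i eᵢ≡x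
      where
      parent : ∀ i → e′ i ≡ x → Acc (flip (Parent f e)) (f (suc i))
      parent i eᵢ≡x with f (suc i) ≟ e zero in d
      ... | yes fᵢ≡e₀ = subst (Acc _) (sym fᵢ≡e₀) (from-f₀ (rooted′ f₀≢e₀
              -- The equation `d` evaluates the test in `contract`, so the contracted parent is
              -- `f zero`.
              (rs (i , eᵢ≡x , cong (λ b → if does b then f zero else f (suc i)) d))))
      ... | no  fᵢ≢e₀ = rooted′ fᵢ≢e₀
              (rs (i , eᵢ≡x , cong (λ b → if does b then f zero else f (suc i)) d))

    rooted : Rooted f e
    rooted x with x ≟ e zero
    ... | yes refl = from-f₀ (rooted′ f₀≢e₀ (wf (f zero)))
    ... | no  x≢e₀ = rooted′ x≢e₀ (wf x)

-- Each elimination contributes a factor -1 and preserves rootedness both ways. Stated as a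
-- disjunction, the result also decides rootedness.
det-parentMatrix : (f e : Fin n → Fin m) → Injective e →
  (Rooted f e × det (parentMatrix f e) ≡ sign n) ⊎ (¬ Rooted f e × det (parentMatrix f e) ≡ 0ℤ)
det-parentMatrix {zero}  f e e-inj = inj₁ ((λ x → acc λ where (() , _)) , refl)
det-parentMatrix {suc n} f e e-inj =
  split (f zero ≟ e zero) (det-parentMatrix (contract f e) (e ∘ suc) (suc-injective ∘ e-inj))
  where
  M = parentMatrix f e

  row-zero : f zero ≡ e zero → ∀ k → M zero k ≡ 0ℤ
  row-zero f₀≡e₀ k = trans (cong (λ x → δ x (e k) - δ (e zero) (e k)) f₀≡e₀)
                           (ℤₚ.+-inverseʳ (δ (e zero) (e k)))

  split : Dec (f zero ≡ e zero) → _ → _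
  -- A vertex that is its own parent gives a zero row and an infinite chain of parents.
  split (yes f₀≡e₀) _ = inj₂
    ((λ wf → acc-irrefl (wf (e zero)) (zero , refl , f₀≡e₀)) ,
     sum-zero _ λ k → row-entry-zero M k (row-zero f₀≡e₀ k))
  split (no f₀≢e₀) (inj₁ (wf , eq)) = inj₁
    (rooted-expand f e e-inj f₀≢e₀ wf , trans (det-contract f e e-inj f₀≢e₀) (cong (-1ℤ *_) eq))
  split (no f₀≢e₀) (inj₂ (¬wf , eq)) = inj₂
    (¬wf ∘ rooted-contract f e e-inj , trans (det-contract f e e-inj f₀≢e₀) (cong (-1ℤ *_) eq))

rooted? : (f e : Fin n → Fin m) → Injective e → Dec (Rooted f e)
rooted? f e e-inj with det-parentMatrix f e e-inj
... | inj₁ (wf , _)  = yes wf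
... | inj₂ (¬wf , _) = no ¬wf

-- Counting in lists, and simple paths.

sumOver-dec : {P : A → Set} (P? : ∀ x → Dec (P x)) (c : ℤ) (g : A → ℤ) →
  (∀ x → (P x × g x ≡ c) ⊎ (¬ P x × g x ≡ 0ℤ)) →
  ∀ xs → sumOver xs g ≡ c * + length (filter P? xs)
sumOver-dec P? c g h []       = sym (ℤₚ.*-zeroʳ c)
sumOver-dec P? c g h (x ∷ xs) with P? x | h x
... | yes _ | inj₁ (_ , eq)  = trans (cong₂ _+_ eq (sumOver-dec P? c g h xs))
                                     (sym (ℤₚ.*-suc c (+ length (filter P? xs))))
... | no _  | inj₂ (_ , eq)  = trans (cong₂ _+_ eq (sumOver-dec P? c g h xs)) (ℤₚ.+-identityˡ _)
... | yes p | inj₂ (¬p , _) = contradiction p ¬p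
... | no ¬p | inj₁ (p , _)  = contradiction p ¬p

T-ext : {a b : Bool} → (T a → T b) → (T b → T a) → a ≡ b
T-ext {true}  {true}  f g = refl
T-ext {true}  {false} f g = contradiction _ f
T-ext {false} {true}  f g = contradiction _ g
T-ext {false} {false} f g = refl

lookup-injective : {xs : List A} → Unique xs → ∀ {i j} → List.lookup xs i ≡ List.lookup xs j → i ≡ j
lookup-injective (_ ∷ _)    {zero}  {zero}  eq = refl
lookup-injective (x∉ ∷ _)   {zero}  {suc j} eq = contradiction eq (All.lookup x∉ (∈-lookup j))
lookup-injective (x∉ ∷ _)   {suc i} {zero}  eq = contradiction (sym eq) (All.lookup x∉ (∈-lookup i))
lookup-injective (_ ∷ uniq) {suc i} {suc j} eq = cong suc (lookup-injective uniq eq)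

least : {P : ℕ → Set} → (∀ k → Dec (P k)) → ∀ k → P k → ∃ λ l → P l × (∀ j → P j → l ≤ j)
least P? zero    p = zero , p , λ _ _ → z≤n
least P? (suc k) p with P? zero
... | yes p₀ = zero , p₀ , λ _ _ → z≤n
... | no ¬p₀ with l , pₗ , minimal ← least (P? ∘ suc) k p = suc l , pₗ , λ where
  zero    p₀ → contradiction p₀ ¬p₀
  (suc j) pⱼ → s≤s (minimal j pⱼ)

∈-choices⁺ : {xs : Fin n → List A} (v : Vec A n) → (∀ i → lookup v i ∈ xs i) → v ∈ choices xs
∈-choices⁺ []      v∈ = here refl
∈-choices⁺ (x ∷ v) v∈ = ∈-cartesianProductWith⁺ _∷_ (v∈ zero) (∈-choices⁺ v (v∈ ∘ suc))

∈-choices⁻ : (xs : Fin n → List A) {v : Vec A n} → v ∈ choices xs → ∀ i → lookup v i ∈ xs i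
∈-choices⁻ {suc n} xs v∈ i with ∈-cartesianProductWith⁻ _∷_ (xs zero) (choices (xs ∘ suc)) v∈
∈-choices⁻ {suc n} xs v∈ zero    | _ , _ , x∈ , w∈ , refl = x∈
∈-choices⁻ {suc n} xs v∈ (suc i) | _ , _ , x∈ , w∈ , refl = ∈-choices⁻ (xs ∘ suc) w∈ i

choices-unique : (xs : Fin n → List A) → (∀ i → Unique (xs i)) → Unique (choices xs)
choices-unique {zero}  xs uniq = [] ∷ []
choices-unique {suc n} xs uniq =
  Unique.cartesianProductWith⁺ _∷_ ∷-injective (uniq zero) (choices-unique (xs ∘ suc) (uniq ∘ suc))

-- The list omits the start but includes the end, so `x ∷ xs` is the full vertex list in the shape
-- used by `IsCycle`.
data Path {A : Set} (R : A → A → Set) : A → List A → A → Set where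
  []  : ∀ {x} → Path R x [] x
  _∷_ : ∀ {x y z ys} → R x y → Path R y ys z → Path R x (y ∷ ys) z

module _ {R : A → A → Set} where

  path-from : ∀ {x y z ys} → Path R y ys z → Unique (y ∷ ys) → x ∈ y ∷ ys →
              ∃ λ xs → Path R x xs z × Unique (x ∷ xs)
  path-from p       uniq       (here refl) = _ , p , uniq
  path-from (_ ∷ p) (_ ∷ uniq) (there x∈)  = path-from p uniq x∈

  path⇒linked : ∀ {x xs z w} → Path R x xs z → R z w → Linked R (x ∷ (xs ∷ʳ w))
  path⇒linked []      r = r ∷ [-]
  path⇒linked (s ∷ p) r = s ∷ path⇒linked p r

-- Loop erasure: if the new start already lies on the simple path found for the rest, the part
-- before it is dropped.
simplePath : {R : Fin m → Fin m → Set} → ∀ {x z} → Star R x z →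
             ∃ λ xs → Path R x xs z × Unique (x ∷ xs)
simplePath ε = [] , [] , [] ∷ []
simplePath {x = x} (_◅_ {j = y} r rs) with simplePath rs
... | ys , p , uniq with Any.any? (x ≟_) (y ∷ ys)
...   | yes x∈ = path-from p uniq x∈
...   | no  x∉ = y ∷ ys , r ∷ p , ¬Any⇒All¬ _ x∉ ∷ uniq

-- Acyclicity of graphs given by a parent relation.

NonBacktracking : List A → Set
NonBacktracking (x ∷ y ∷ z ∷ xs) = x ≢ z × NonBacktracking (y ∷ z ∷ xs)
NonBacktracking _                = ⊤

nonBacktracking : ∀ {z : A} x y ys → Unique (x ∷ y ∷ ys) → All (_≢ z) (x ∷ y ∷ ys) →
                  NonBacktracking (x ∷ y ∷ (ys ∷ʳ z))
nonBacktracking x y []       uniq (x≢z ∷ _) = x≢z , _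
nonBacktracking x y (w ∷ ys) ((_ ∷ x≢w ∷ _) ∷ uniq) (_ ∷ ≢z) = x≢w , nonBacktracking y w ys uniq ≢z

module _ {P E : A → A → Set}
  (functional : ∀ {x y z} → P x y → P x z → y ≡ z)
  (wf : WellFounded (flip P))
  (E⇒P : ∀ {x y} → E x y → P x y ⊎ P y x) where

  private
    _⇑_ : A → A → Set
    _⇑_ = TransClosure P

  ⇑-irrefl : ∀ {x} → ¬ x ⇑ x
  ⇑-irrefl = acc-irrefl (Transitive.accessible _ (wf _)) ∘ flipped
    where
    flipped : ∀ {x y} → x ⇑ y → TransClosure (flip P) y x
    flipped [ p ]    = [ p ]
    flipped (p ∷ ps) = flipped ps Transitive.∷ʳ p

  -- After a step to a child, a step up could only return to `x`, as parents are unique, and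
  -- backtracking is excluded. The witness `w` is the vertex just before `z`.
  descends : ∀ {x y z} ys → P y x → NonBacktracking (x ∷ y ∷ (ys ∷ʳ z)) →
             Linked E (y ∷ (ys ∷ʳ z)) → z ⇑ x × ∃ λ w → w ∈ y ∷ ys × P z w
  descends [] p (x≢z , _) (e ∷ _) with E⇒P e
  ... | inj₁ q = contradiction (functional p q) x≢z
  ... | inj₂ q = q ∷ [ p ] , _ , here refl , q
  descends (y′ ∷ ys) p (x≢y′ , nb) (e ∷ es) with E⇒P e
  ... | inj₁ q = contradiction (functional p q) x≢y′
  ... | inj₂ q with descends ys q nb es
  ...   | qs , w , w∈ , r = qs Transitive.∷ʳ p , w , there w∈ , r

  -- Either all steps go up, or `descends` applies from the first step down, and `z` is reached from
  -- its parent.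
  ascends-or-descends : ∀ {x z} y ys → NonBacktracking (x ∷ y ∷ (ys ∷ʳ z)) →
                        Linked E (x ∷ y ∷ (ys ∷ʳ z)) → x ⇑ z ⊎ ∃ λ w → w ∈ y ∷ ys × P z w
  ascends-or-descends y ys nb (e ∷ es) with E⇒P e
  ... | inj₂ q = inj₂ (proj₂ (descends ys q nb es))
  ascends-or-descends y [] nb (e ∷ e′ ∷ _) | inj₁ q with E⇒P e′
  ... | inj₁ q′ = inj₁ (q ∷ [ q′ ])
  ... | inj₂ q′ = inj₂ (y , here refl , q′)
  ascends-or-descends y (y′ ∷ ys) (_ , nb) (e ∷ es) | inj₁ q with ascends-or-descends y′ ys nb es
  ... | inj₁ qs           = inj₁ (q ∷ qs)
  ... | inj₂ (w , w∈ , r) = inj₂ (w , there w∈ , r)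

  -- A non-backtracking walk that once moves to a child keeps moving to children,
  -- so on a cycle through x both neighbours of x would be its parent.
  no-cycle : ∀ x xs → 2 ≤ length xs → Unique (x ∷ xs) → ¬ Linked E (x ∷ (xs ∷ʳ x))
  no-cycle x (y ∷ [])      (s≤s ())
  no-cycle x (y ∷ y′ ∷ ys) _ (x∉@(_ ∷ x≢y′ ∷ _) ∷ uniq@(y∉ ∷ _)) (e ∷ es) = first-step (E⇒P e)
    where
    nb : NonBacktracking (y ∷ y′ ∷ (ys ∷ʳ x))
    nb = nonBacktracking y y′ ys uniq (All.map ≢-sym x∉)

    first-step : P x y ⊎ P y x → ⊥
    first-step (inj₂ q) = ⇑-irrefl (proj₁ (descends (y′ ∷ ys) q (x≢y′ , nb) es))
    first-step (inj₁ q) with ascends-or-descends y′ ys nb es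
    ... | inj₁ qs           = ⇑-irrefl (q ∷ qs)
    -- Both `y` and `w` are the parent of `x`, but `y` does not recur among the later vertices.
    ... | inj₂ (w , w∈ , r) = All.lookup y∉ w∈ (functional q r)

-- Parent functions and spanning trees.

parent-functional : {f e : Fin n → Fin m} → Injective e →
                    ∀ {x y z} → Parent f e x y → Parent f e x z → y ≡ z
parent-functional {f = f} e-inj (i , eᵢ≡x , fᵢ≡y) (j , eⱼ≡x , fⱼ≡z) =
  trans (sym fᵢ≡y) (trans (cong f (e-inj (trans eᵢ≡x (sym eⱼ≡x)))) fⱼ≡z)

parent? : (f e : Fin n → Fin m) → ∀ x y → Dec (Parent f e x y)
parent? f e x y = any? λ i → (e i ≟ x) ×-dec (f i ≟ y)

module _ (G : SimpleGraph (suc n)) (r : Fin (suc n)) where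

  private
    module G = SimpleGraph G
    e : Fin n → Fin (suc n)
    e = punchIn r
    e-inj : Injective e
    e-inj = punchIn-injective r _ _

    index : ∀ {x} → x ≢ r → ∃ λ i → e i ≡ x
    index x≢r = punchOut (x≢r ∘ sym) , punchIn-punchOut (x≢r ∘ sym)

  Linking : (f : Fin n → Fin (suc n)) → Fin (suc n) → Fin (suc n) → Set
  Linking f x y = Parent f e x y ⊎ Parent f e y x

  linking? : ∀ f x y → Dec (Linking f x y)
  linking? f x y = parent? f e x y ⊎-dec parent? f e y x

  record ParentFunction (f : Fin n → Fin (suc n)) : Set where
    field
      rooted   : Rooted f e
      adjacent : ∀ i → T (G.edge (e i) (f i))

  linking-within : (H : Subgraph G) {f : Fin n → Fin (suc n)} →
                   (∀ i → Subgraph.Adj H (e i) (f i)) →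
                   ∀ {x y} → Linking f x y → Subgraph.Adj H x y
  linking-within H f⊆H (inj₁ (i , refl , refl)) = f⊆H i
  linking-within H f⊆H (inj₂ (i , refl , refl)) = subst T (Subgraph.edge-sym H _ _) (f⊆H i)

  module _ {f : Fin n → Fin (suc n)} (F : ParentFunction f) where
    open ParentFunction F

    parentSubgraph : Subgraph G
    parentSubgraph = record
      { vertices      = Subset.⊤
      ; edge          = λ x y → isYes (linking? f x y)
      ; edge-sym      = λ x y → T-ext (fromWitness ∘ swap ∘ toWitness)
                                      (fromWitness ∘ swap ∘ toWitness)
      ; edge-in-graph = λ x y → in-graph ∘ toWitness
      ; edge-source   = λ _ _ _ → ∈⊤
      }
      where
      in-graph : ∀ {x y} → Linking f x y → T (G.edge x y)
      in-graph (inj₁ (i , refl , refl)) = adjacent i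
      in-graph (inj₂ (i , refl , refl)) = subst T (G.edge-sym (e i) (f i)) (adjacent i)

    linking-connected : ∀ x y → Star (Linking f) x y
    linking-connected x y = to-root (rooted x) ◅◅ reverse swap (to-root (rooted y))
      where
      to-root : ∀ {x} → Acc (flip (Parent f e)) x → Star (Linking f) x r
      to-root {x} (acc rs) with x ≟ r
      ... | yes refl = ε
      ... | no  x≢r with index x≢r
      ...   | i , eᵢ≡x = inj₁ (i , eᵢ≡x , refl) ◅ to-root (rs (i , eᵢ≡x , refl))

    parentTree : SpanningTree G
    parentTree = parentSubgraph ,
      ( (r , ∈⊤)
      , (λ x y _ _ → gmap id fromWitness (linking-connected x y))
      , λ x xs (2≤ , uniq , linked) →
          no-cycle {P = Parent f e} (parent-functional e-inj) rooted toWitness x xs 2≤ uniq linked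
      ) , λ _ → ∈⊤

    -- An edge x-y of H outside the tree would close the tree path from x to y
    -- to a cycle.
    acyclic⇒linking : (H : Subgraph G) → Subgraph.Acyclic H →
                      (∀ i → Subgraph.Adj H (e i) (f i)) →
                      ∀ x y → Subgraph.Adj H x y → Linking f x y
    acyclic⇒linking H acyclic f⊆H x y x-y with linking? f x y
    ... | yes link = link
    ... | no ¬link with simplePath (linking-connected x y)
    -- Without edges the path makes `x` a loop, and a single edge is a link; otherwise at least two
    -- vertices follow `x`, as `IsCycle` demands.
    ...   | [] , [] , _ = ⊥-elim (subst T (G.edge-irrefl x) (Subgraph.edge-in-graph H x x x-y))
    ...   | _ ∷ [] , link ∷ [] , _ = contradiction link ¬link
    ...   | xs@(_ ∷ _ ∷ _) , path , uniq = contradiction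
            (s≤s (s≤s z≤n) , uniq , path⇒linked (map-path path) y-x)
            (acyclic x xs)
      where
      y-x : Subgraph.Adj H y x
      y-x = subst T (Subgraph.edge-sym H x y) x-y

      map-path : ∀ {x xs y} → Path (Linking f) x xs y → Path (Subgraph.Adj H) x xs y
      map-path []      = []
      map-path (l ∷ p) = linking-within H f⊆H l ∷ map-path p

  -- Induction along `g` towards the root. If the link from `e i` to `g i` were reversed in `f`,
  -- then `f` and `g` would agree at `g i` by induction, and `e i` and `g i` would be parents of
  -- each other under `g`.
  linking-injective : ∀ {f g} → ParentFunction f → ParentFunction g →
    (∀ x y → Linking g x y → Linking f x y) → ∀ i → f i ≡ g i
  linking-injective {f} {g} F G g⊆f i = agree (ParentFunction.rooted G (e i)) i refl
    where
    agree : ∀ {x} → Acc (flip (Parent g e)) x → ∀ i → e i ≡ x → f i ≡ g i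
    agree (acc rs) i refl with g⊆f (e i) (g i) (inj₁ (i , refl , refl))
    ... | inj₁ (j , eⱼ≡eᵢ , fⱼ≡gᵢ) = trans (cong f (e-inj (sym eⱼ≡eᵢ))) fⱼ≡gᵢ
    ... | inj₂ (j , eⱼ≡gᵢ , fⱼ≡eᵢ) = ⊥-elim (acc-irrefl
            (Transitive.accessible _ (ParentFunction.rooted G (e i)))
            ((j , eⱼ≡gᵢ , trans (sym (agree (rs (i , refl , refl)) j eⱼ≡gᵢ)) fⱼ≡eᵢ) ∷
             [ i , refl , refl ]))

  -- Breadth-first search: the parent is a neighbour strictly closer to r.
  parentOf : (H : Subgraph G) → (∀ x → Star (Subgraph.Adj H) x r) →
             ∃ λ v → Rooted (lookup v) e × (∀ i → Subgraph.Adj H (e i) (lookup v i))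
  parentOf H connected = v , rooted , edge-v
    where
    open Subgraph H

    -- Walks of exactly `k` edges, which a finite search decides; `nearest` then selects the
    -- shortest.
    Reach : ℕ → Fin (suc n) → Set
    Reach zero    x = x ≡ r
    Reach (suc k) x = ∃ λ y → Adj x y × Reach k y

    reach? : ∀ k x → Dec (Reach k x)
    reach? zero    x = x ≟ r
    reach? (suc k) x = any? λ y → T? (edge x y) ×-dec reach? k y

    reachable : ∀ {x} → Star Adj x r → ∃ λ k → Reach k x
    reachable ε = zero , refl
    reachable (a ◅ as) with k , reach ← reachable as = suc k , _ , a , reach

    nearest : ∀ x → ∃ λ k → Reach k x × (∀ j → Reach j x → k ≤ j)
    nearest x with k , reach ← reachable (connected x) = least (λ k → reach? k x) k reach

    depth : Fin (suc n) → ℕ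
    depth x = proj₁ (nearest x)

    closer : ∀ {x} → x ≢ r → ∃ λ y → Adj x y × depth y < depth x
    closer {x} x≢r with nearest x
    ... | zero  , x≡r , _ = contradiction x≡r x≢r
    -- The next vertex on a shortest walk reaches `r` in `k` steps, so its depth is at most `k`.
    ... | suc k , (y , a , reach) , _ = y , a , s≤s (proj₂ (proj₂ (nearest y)) k reach)

    v : Vec (Fin (suc n)) n
    v = Vec.tabulate λ i → proj₁ (closer (punchInᵢ≢i r i))

    v-closer : ∀ i → Adj (e i) (lookup v i) × depth (lookup v i) < depth (e i)
    v-closer i = subst (λ y → Adj (e i) y × depth y < depth (e i))
      (sym (lookup∘tabulate _ i)) (proj₂ (closer (punchInᵢ≢i r i)))

    edge-v : ∀ i → Adj (e i) (lookup v i)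
    edge-v = proj₁ ∘ v-closer

    rooted : Rooted (lookup v) e
    rooted = Subrelation.wellFounded decreasing (On.wellFounded depth <-wellFounded)
      where
      decreasing : ∀ {x y} → Parent (lookup v) e y x → depth x < depth y
      decreasing (i , refl , refl) = proj₂ (v-closer i)

  -- Enumeration of the spanning trees.

  rootedVector? : ∀ v → Dec (Rooted (lookup v) e)
  rootedVector? v = rooted? (lookup v) e e-inj

  -- A filter of `choices`, the form in which `sumOver-dec` evaluates the minor.
  parentVectors : List (Vec (Fin (suc n)) n)
  parentVectors = filter rootedVector? (choices (neighbours G ∘ e))

  parentVectors-unique : Unique parentVectors
  parentVectors-unique = Unique.filter⁺ rootedVector? (choices-unique (neighbours G ∘ e) λ i →
    Unique.filter⁺ (T? ∘ G.edge (e i)) (Unique.allFin⁺ (suc n)))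

  ∈-parentVectors⁻ : ∀ {v} → v ∈ parentVectors → ParentFunction (lookup v)
  ∈-parentVectors⁻ v∈ with v∈choices , rooted ← ∈-filter⁻ rootedVector? v∈ = record
    { rooted   = rooted
    ; adjacent = λ i → proj₂ (∈-filter⁻ (T? ∘ G.edge (e i)) {xs = List.allFin (suc n)}
                                (∈-choices⁻ (neighbours G ∘ e) v∈choices i))
    }

  ∈-parentVectors⁺ : ∀ v → ParentFunction (lookup v) → v ∈ parentVectors
  ∈-parentVectors⁺ v F = ∈-filter⁺ rootedVector?
    (∈-choices⁺ v λ i → ∈-filter⁺ (T? ∘ G.edge (e i)) (∈-allFin _) (adjacent i)) rooted
    where open ParentFunction F

  treeAt : Fin (length parentVectors) → SpanningTree G
  treeAt k = parentTree (∈-parentVectors⁻ (∈-lookup k))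

  treeAt-injective : ∀ {k l} → proj₁ (treeAt k) ≈ proj₁ (treeAt l) → k ≡ l
  treeAt-injective {k} {l} (_ , same-edges) = lookup-injective parentVectors-unique (begin
    v                       ≡⟨ tabulate∘lookup v ⟨
    Vec.tabulate (lookup v) ≡⟨ tabulate-cong (linking-injective
        (∈-parentVectors⁻ (∈-lookup k)) (∈-parentVectors⁻ (∈-lookup l))
        λ x y → toWitness ∘ subst T (sym (same-edges x y)) ∘ fromWitness) ⟩
    Vec.tabulate (lookup w) ≡⟨ tabulate∘lookup w ⟩
    w                       ∎)
    where
    v = List.lookup parentVectors k
    w = List.lookup parentVectors l

  -- Breadth-first search in `H` yields parents whose links lie in `H`; acyclicity of `H` leaves no
  -- other edges.
  treeAt-surjective : (H : SpanningTree G) → ∃ λ k → proj₁ (treeAt k) ≈ proj₁ H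
  treeAt-surjective (H , (_ , connected , acyclic) , spanning)
    with v , rooted , v⊆H ← parentOf H (λ x → connected x r (spanning x) (spanning r))
    = k , ⊆-antisym (λ _ → spanning _) ⊆⊤ , λ x y →
      trans (cong (λ w → isYes (linking? (lookup w) x y)) (sym (lookup-index v∈)))
            (T-ext (linking-within H v⊆H ∘ toWitness)
                   (fromWitness ∘ acyclic⇒linking F H acyclic v⊆H x y))
    where
    F : ParentFunction (lookup v)
    F = record { rooted = rooted ; adjacent = λ i → Subgraph.edge-in-graph H _ _ (v⊆H i) }

    v∈ : v ∈ parentVectors
    v∈ = ∈-parentVectors⁺ v F

    k : Fin (length parentVectors)
    k = Any.index v∈

  -- `treeAt` runs from indices to trees, whereas `_HasCardinality_` asks for the opposite
  -- direction, hence the inversion.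
  spanningTrees-cardinality : spanningTrees G HasCardinality length parentVectors
  spanningTrees-cardinality = Inverse⇒Bijection (Inverse-sym (Bijection⇒Inverse treeAt-bijection))
    where
    treeAt-bijection : Bijection (setoid (Fin (length parentVectors))) (spanningTrees G)
    treeAt-bijection = record
      { to        = treeAt
      ; cong      = λ { refl → Setoid.refl (spanningTrees G) {treeAt _} }
      ; bijective = treeAt-injective , λ H →
          let k , k≈H = treeAt-surjective H in k , λ { refl → k≈H }
      }

  det-minor-count : det (minor r r G.laplacian) ≡ sign n * + length parentVectors
  det-minor-count = trans (det-minor-laplacian G e)
    (sumOver-dec rootedVector? (sign n)
      (λ v → det (parentMatrix (lookup v) e))
      (λ v → det-parentMatrix (lookup v) e e-inj)
      (choices (neighbours G ∘ e)))

-- Comparison of different roots.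

∣sign∣ : ∀ k → ∣ sign k ∣ ≡ 1
∣sign∣ zero    = refl
∣sign∣ (suc k) = trans (ℤₚ.abs-* -1ℤ (sign k)) (trans (ℕₚ.*-identityˡ _) (∣sign∣ k))

cardinality-unique : {S : Setoid 0ℓ 0ℓ} {k l : ℕ} → S HasCardinality k → S HasCardinality l → k ≡ l
cardinality-unique p q =
  ↔⇒≡ (Inverse-trans (Inverse-sym (Bijection⇒Inverse p)) (Bijection⇒Inverse q))

corollary2 : (n : ℕ) (G : SimpleGraph (suc n)) →
    ∃[ c ] (IsCommonCofactor (SimpleGraph.laplacian G) c ×
    spanningTrees G HasCardinality ∣ c ∣)
corollary2 n G = sign n * + count zero , common ,
  subst (spanningTrees G HasCardinality_) (sym abs-count) (spanningTrees-cardinality G zero)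
  where
  L = SimpleGraph.laplacian G

  count : Fin (suc n) → ℕ
  count r = length (parentVectors G r)

  common : IsCommonCofactor L (sign n * + count zero)
  common i j = begin
    cofactor i j L           ≡⟨ cofactor-diagonal L (laplacian-rowSumsZero G) i j ⟩
    det (minor i i L)        ≡⟨ det-minor-count G i ⟩
    sign n * + count i
      -- The parent vectors for both roots are in bijection with the same spanning trees, so their
      -- numbers agree.
      ≡⟨ cong (λ k → sign n * + k) (cardinality-unique (spanningTrees-cardinality G i)
                                                      (spanningTrees-cardinality G zero)) ⟩
    sign n * + count zero    ∎

  abs-count : ∣ sign n * + count zero ∣ ≡ count zero
  abs-count = trans (ℤₚ.abs-* (sign n) (+ count zero))
    (trans (cong (ℕ._* count zero) (∣sign∣ n)) (ℕₚ.*-identityˡ (count zero)))
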